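{- There exists a constant $c$ such that for each $n\in\mathbb N$ and each $n$-ary Boolean function $f:\mathbb B^n\to\mathbb B$, there exists an instruction sequence $X\in\mathcal{IS}^{0}_{br}$ in which no jump instruction other than $\#2$ occurs, such that $X$ computes $f$ and $|X|\le c\cdot 2^n$ (i.e. $|X|=O(2^n)$).
   Context: Let $\mathbb B=\{\mathsf T,\mathsf F\}$. There are Boolean registers named $\mathtt{in}{:}i$ ($i\ge1$, input registers), $\mathtt{aux}{:}i$ ($i\ge1$, auxiliary registers) and $\mathtt{out}$ (output register). A Boolean register can process the methods $\mathtt{set{:}T}$ (content becomes $\mathsf T$, reply $\mathsf T$), $\mathtt{set{:}F}$ (content becomes $\mathsf F$, reply $\mathsf F$) and $\mathtt{get}$ (nothing changes, reply is the content). A basic instruction has the form $f.m$ with $f$ a register name and $m$ a method. Primitive instructions are: for each basic instruction $a$, the plain basic instruction $a$, the positive test instruction $+a$ and the negative test instruction $-a$; for each $l\in\mathbb N$ the forward jump instruction $\#l$; and the termination instruction $!$. An instruction sequence is a finite non-empty sequence $X=u_1;\dots;u_k$ of primitive instructions; its length is $|X|=k$. Execution starts at $u_1$: for $a$, $a$ is executed and execution proceeds with the next instruction; for $+a$, $a$ is executed and execution proceeds with the next instruction if the reply is $\mathsf T$, otherwise the next instruction is skipped and execution proceeds with the one after it; $-a$ is the same with the role of the reply reversed; for $\#l$ execution proceeds with the $l$-th next instruction ($\#0$ causes inaction); $!$ terminates execution; if there is no instruction to proceed with, inaction occurs. $\mathcal{IS}_{br}$ is the set of instruction sequences in which every basic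 instruction is of the form $\mathtt{in}{:}i.\mathtt{get}$, $\mathtt{aux}{:}i.\mathtt{get}$, $\mathtt{aux}{:}i.\mathtt{set{:}}b$ or $\mathtt{out}.\mathtt{set{:}}b$ ($i\ge1$, $b\in\mathbb B$). For $k,l\in\mathbb N$, $\mathcal{IS}^{k,l}_{br}$ is the set of $X\in\mathcal{IS}_{br}$ in which no instruction involving a register $\mathtt{aux}{:}i$ with $i>k$ and no jump $\#l'$ with $l'>l$ occurs; $\mathcal{IS}^{k}_{br}=\bigcup_{l\in\mathbb N}\mathcal{IS}^{k,l}_{br}$ (so $\mathcal{IS}^0_{br}$ uses no auxiliary registers). For $f:\mathbb B^n\to\mathbb B$, $X\in\mathcal{IS}_{br}$ computes $f$ if for all $b_1,\dots,b_n\in\mathbb B$: when $X$ is executed with $\mathtt{in}{:}i$ initially containing $b_i$ ($1\le i\le n$) and all auxiliary registers and $\mathtt{out}$ initially containing $\mathsf F$, execution never executes an instruction on an input register $\mathtt{in}{:}i$ with $i>n$, ends by executing $!$ (not by inaction), and the final content of $\mathtt{out}$ is $f(b_1,\dots,b_n)$. -}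

module Defs where

open import Data.Bool using (Bool; true; false; if_then_else_)
open import Data.Nat using (ℕ; zero; suc; _<_; _≡ᵇ_)
open import Data.Nat.Properties using (_<?_)
open import Data.List using (List; []; _∷_; length)
open import Data.List.Relation.Unary.All using (All)
open import Data.Vec using (Vec; lookup)
open import Data.Fin using (fromℕ<)
open import Data.Maybe using (Maybe; just; nothing)
open import Data.Product using (∃; _×_; _,_)
open import Relation.Binary.PropositionalEquality using (_≡_; _≢_)
open import Relation.Nullary using (yes; no; ¬_)

-- Basic instructions of IS_br.  Register indices are shifted by one:
--   inGet i    is  in:(i+1).get
--   auxGet i   is  aux:(i+1).get
--   auxSet i b is  aux:(i+1).set:b
--   outSet b   is  out.set:b
data Basic : Set where
  inGet  : ℕ → Basic
  auxGet : ℕ → Basic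
  auxSet : ℕ → Bool → Basic
  outSet : Bool → Basic

data Instr : Set where
  plain : Basic → Instr
  ptest : Basic → Instr
  ntest : Basic → Instr
  jump  : ℕ → Instr
  halt  : Instr

-- Instruction sequences of IS_br (non-emptiness is enforced in the
-- theorem separately; it is also implied by computing a function).
InstrSeq : Set
InstrSeq = List Instr

record State : Set where
  constructor st
  field
    aux : ℕ → Bool
    out : Bool
open State public

initState : State
initState = st (λ _ → false) false

data Outcome : Set where
  terminated : State → Outcome
  inaction   : Outcome
  badInput   : Outcome
  outOfFuel  : Outcome

updAux : (ℕ → Bool) → ℕ → Bool → ℕ → Bool
updAux r i b j = if i ≡ᵇ j then b else r j

execBasic : ∀ {n} → Vec Bool n → State → Basic → Maybe (Bool × State)
execBasic {n} bs s (inGet i) with i <? n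
... | yes p = just (lookup bs (fromℕ< p) , s)
... | no _  = nothing
execBasic bs s (auxGet i)   = just (aux s i , s)
execBasic bs s (auxSet i b) = just (b , st (updAux (aux s) i b) (out s))
execBasic bs s (outSet b)   = just (b , st (aux s) b)

lookupInstr : InstrSeq → ℕ → Maybe Instr
lookupInstr []      _       = nothing
lookupInstr (u ∷ _) zero    = just u
lookupInstr (_ ∷ X) (suc k) = lookupInstr X k

run : ∀ {n} → ℕ → InstrSeq → Vec Bool n → ℕ → State → Outcome
run zero X bs pc s = outOfFuel
run (suc fuel) X bs pc s with lookupInstr X pc
... | nothing = inaction
... | just halt = terminated s
... | just (jump zero) = inaction
... | just (jump (suc l)) = run fuel X bs (pc Data.Nat.+ suc l) s
... | just (plain a) with execBasic bs s a
...   | nothing = badInput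
...   | just (_ , s') = run fuel X bs (suc pc) s'
run (suc fuel) X bs pc s | just (ptest a) with execBasic bs s a
...   | nothing = badInput
...   | just (true , s')  = run fuel X bs (suc pc) s'
...   | just (false , s') = run fuel X bs (suc (suc pc)) s'
run (suc fuel) X bs pc s | just (ntest a) with execBasic bs s a
...   | nothing = badInput
...   | just (true , s')  = run fuel X bs (suc (suc pc)) s'
...   | just (false , s') = run fuel X bs (suc pc) s'

Computes : (n : ℕ) → InstrSeq → (Vec Bool n → Bool) → Set
Computes n X f = (bs : Vec Bool n) →
  ∃ λ fuel → ∃ λ s → run fuel X bs 0 initState ≡ terminated s × out s ≡ f bs

data NoAuxB : Basic → Set where
  inGet-ok  : ∀ i → NoAuxB (inGet i)
  outSet-ok : ∀ b → NoAuxB (outSet b)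

data NoAuxOnlyJump2 : Instr → Set where
  plain-ok : ∀ {a} → NoAuxB a → NoAuxOnlyJump2 (plain a)
  ptest-ok : ∀ {a} → NoAuxB a → NoAuxOnlyJump2 (ptest a)
  ntest-ok : ∀ {a} → NoAuxB a → NoAuxOnlyJump2 (ntest a)
  jump2-ok : NoAuxOnlyJump2 (jump 2)
  halt-ok  : NoAuxOnlyJump2 halt

{-# OPTIONS --safe #-}

-- With jumps #2 only, every execution passes through one of any two adjacent positions, so a block
-- of code can be entered at offset 0 or 1 and receives just one bit from the code before it.  Two
-- instructions per rule let a block overwrite this bit by constants depending on single inputs; at the
-- end of the block the execution either halts with a fixed output or goes on to the next block.
--
-- For an input vector y, two such blocks of length O(n) let every x ≤ y (entrywise) halt, with the
-- right output f x whenever x is y or y with one entry lowered.  Take a set C of vectors such that every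
-- x lies in C or can be moved into C by raising one entry, and run through C by increasing weight:
-- the first y ≥ x met has weight at most |x| + 1, so x halts with output f x.  It remains to find C with
-- |C| = O(2^n / n).  A Hamming-type code with three repeated parts covers all words but a quarter;
-- the exceptions are covered recursively by a code of about half the length on further coordinates,
-- and the densities sum geometrically.
module Submission where

open import Defs
open import Data.Bool using (Bool; true; false; if_then_else_; not; _≟_; _xor_)
open import Data.Bool.Properties
  using (not-¬; ¬-not; if-eta; xor-assoc; xor-comm; xor-same; not-distribˡ-xor; not-distribʳ-xor)
open import Data.Empty using (⊥-elim)
open import Data.Fin as Fin using (Fin; zero; suc; toℕ)
open import Data.Fin.Properties using (toℕ<n; fromℕ<-toℕ)
open import Data.Fin.Subset using (∣_∣)
open import Data.List as List
  using (List; []; _∷_; _++_; length; map; filter; concatMap; allFin; cartesianProductWith)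
open import Data.List.Membership.Propositional using (_∈_; lose)
open import Data.List.Membership.Propositional.Properties
  using (∈-filter⁺; ∈-filter⁻; ∈-map⁺; ∈-map⁻; ∈-allFin; ∈-++⁺ˡ; ∈-++⁺ʳ; ∈-concatMap⁺;
         ∈-cartesianProductWith⁺)
open import Data.List.Properties using (length-map; length-++; length-filter; length-tabulate; ++-assoc)
open import Data.List.Relation.Binary.Permutation.Propositional using (↭-sym)
open import Data.List.Relation.Binary.Permutation.Propositional.Properties using (∈-resp-↭; ↭-length)
open import Data.List.Relation.Unary.All as All using (All; []; _∷_)
open import Data.List.Relation.Unary.All.Properties using (++⁺; map⁺; concat⁺)
open import Data.List.Relation.Unary.AllPairs using (AllPairs; []; _∷_)
open import Data.List.Relation.Unary.Any using (here; there; index)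
open import Data.List.Relation.Unary.Any.Properties using (lookup-index)
open import Data.List.Relation.Unary.Linked.Properties using (Linked⇒AllPairs)
import Data.List.Sort as Sort
open import Data.Maybe using (just; nothing)
open import Data.Nat using (ℕ; zero; suc; _+_; _*_; _^_; _≤_; _<_; _<?_; _≤?_; z≤n; s≤s)
open import Data.Nat.Properties hiding (_≟_; _<?_; _≤?_)
open import Data.Nat.Tactic.RingSolver using (solve-∀)
open import Data.Product using (∃; _×_; _,_; proj₂)
open import Data.Sum using (_⊎_; inj₁; inj₂)
open import Data.Vec as Vec
  using (Vec; []; _∷_; lookup; _[_]≔_; updateAt; insertAt; removeAt; zipWith; replicate; splitAt)
open import Data.Vec.Properties
  using (insertAt-removeAt; zipWith-assoc; zipWith-comm; lookup∘update; lookup∘update′)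
open import Relation.Binary.Bundles using (DecTotalOrder)
import Relation.Binary.Construct.On as On
open import Relation.Binary.PropositionalEquality
  using (_≡_; _≢_; refl; sym; trans; cong; cong₂; subst; module ≡-Reasoning)
open import Relation.Nullary using (yes; no; does)
open import Relation.Nullary.Decidable using (dec-true; dec-false)

-- Lengths of concatenated and product lists

length-concatMap-≤ : ∀ {A B : Set} {k} (f : A → List B) → (∀ a → length (f a) ≤ k) →
  ∀ xs → length (concatMap f xs) ≤ length xs * k
length-concatMap-≤ f h [] = z≤n
length-concatMap-≤ f h (x ∷ xs) =
  ≤-trans (≤-reflexive (length-++ (f x))) (+-mono-≤ (h x) (length-concatMap-≤ f h xs))

All-concatMap : ∀ {A B : Set} {P : B → Set} (f : A → List B) → (∀ a → All P (f a)) → ∀ xs → All P (concatMap f xs)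
All-concatMap f h xs = concat⁺ (map⁺ (All.universal h xs))

length-cartesianProductWith : ∀ {A B C : Set} (f : A → B → C) xs ys →
  length (cartesianProductWith f xs ys) ≡ length xs * length ys
length-cartesianProductWith f []       ys = refl
length-cartesianProductWith f (x ∷ xs) ys =
  trans (length-++ (map (f x) ys)) (cong₂ _+_ (length-map (f x) ys) (length-cartesianProductWith f xs ys))

-- The factor `c` expresses a proportion, such as one quarter, without division.
length-concatMap : ∀ {A B : Set} c {k} (f : A → List B) → (∀ a → c * length (f a) ≡ k) →
  ∀ xs → c * length (concatMap f xs) ≡ length xs * k
length-concatMap c f h []       = *-zeroʳ c
length-concatMap c {k} f h (x ∷ xs) = begin
  c * length (f x ++ concatMap f xs)                ≡⟨ cong (c *_) (length-++ (f x)) ⟩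
  c * (length (f x) + length (concatMap f xs))      ≡⟨ *-distribˡ-+ c (length (f x)) _ ⟩
  c * length (f x) + c * length (concatMap f xs)    ≡⟨ cong₂ _+_ (h x) (length-concatMap c f h xs) ⟩
  k + length xs * k                                 ∎
  where open ≡-Reasoning

-- Covering codes in the cube ordered by inclusion

infix 4 _⋖_
data _⋖_ : ∀ {n} → Vec Bool n → Vec Bool n → Set where
  here  : ∀ {n} {x : Vec Bool n} → (false ∷ x) ⋖ (true ∷ x)
  there : ∀ {n b} {x y : Vec Bool n} → x ⋖ y → (b ∷ x) ⋖ (b ∷ y)

⋖-++ʳ : ∀ {m n} {x y : Vec Bool m} (z : Vec Bool n) → x ⋖ y → (x Vec.++ z) ⋖ (y Vec.++ z)
⋖-++ʳ z here      = here
⋖-++ʳ z (there p) = there (⋖-++ʳ z p)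

⋖-++ˡ : ∀ {m n} {x y : Vec Bool n} (z : Vec Bool m) → x ⋖ y → (z Vec.++ x) ⋖ (z Vec.++ y)
⋖-++ˡ []      p = p
⋖-++ˡ (_ ∷ z) p = there (⋖-++ˡ z p)

-- One-sided on purpose: a block built for `y` can stop only vectors below `y`, so the code word
-- must lie above `x`.
data Near {n} (x y : Vec Bool n) : Set where
  same  : x ≡ y → Near x y
  below : x ⋖ y → Near x y

Near-++ʳ : ∀ {m n} {x y : Vec Bool m} (z : Vec Bool n) → Near x y → Near (x Vec.++ z) (y Vec.++ z)
Near-++ʳ z (same refl) = same refl
Near-++ʳ z (below p)   = below (⋖-++ʳ z p)

Near-++ˡ : ∀ {m n} {x y : Vec Bool n} (z : Vec Bool m) → Near x y → Near (z Vec.++ x) (z Vec.++ y)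
Near-++ˡ z (same refl) = same refl
Near-++ˡ z (below p)   = below (⋖-++ˡ z p)

infix 4 _⊑_
_⊑_ : ∀ {n} → Vec Bool n → Vec Bool n → Set
x ⊑ y = ∀ j → lookup y j ≡ false → lookup x j ≡ false

-- The witness `k` names the rule by which the block for `y` detects that `x` does not lie below
-- `y`.
⊑-or-outside : ∀ {n} (x y : Vec Bool n) → x ⊑ y ⊎ ∃ λ k → lookup x k ≡ true × lookup y k ≡ false
⊑-or-outside [] [] = inj₁ λ ()
⊑-or-outside (true ∷ x) (false ∷ y) = inj₂ (zero , refl , refl)
⊑-or-outside (false ∷ x) (b ∷ y) with ⊑-or-outside x y
... | inj₂ (k , xk , yk) = inj₂ (suc k , xk , yk)
... | inj₁ p = inj₁ λ { zero _ → refl ; (suc j) → p j }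
⊑-or-outside (true ∷ x) (true ∷ y) with ⊑-or-outside x y
... | inj₂ (k , xk , yk) = inj₂ (suc k , xk , yk)
... | inj₁ p = inj₁ λ { zero () ; (suc j) → p j }

⊑⇒∣∣≤ : ∀ {n} (x y : Vec Bool n) → x ⊑ y → ∣ x ∣ ≤ ∣ y ∣
⊑⇒∣∣≤ [] [] p = z≤n
⊑⇒∣∣≤ (false ∷ x) (false ∷ y) p = ⊑⇒∣∣≤ x y (λ j → p (suc j))
⊑⇒∣∣≤ (false ∷ x) (true  ∷ y) p = m≤n⇒m≤1+n (⊑⇒∣∣≤ x y (λ j → p (suc j)))
⊑⇒∣∣≤ (true  ∷ x) (false ∷ y) p = ⊥-elim (not-¬ (p zero refl) refl)
⊑⇒∣∣≤ (true  ∷ x) (true  ∷ y) p = s≤s (⊑⇒∣∣≤ x y (λ j → p (suc j)))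

⊑-∣∣≤⇒≡ : ∀ {n} (x y : Vec Bool n) → x ⊑ y → ∣ y ∣ ≤ ∣ x ∣ → x ≡ y
⊑-∣∣≤⇒≡ [] [] p q = refl
⊑-∣∣≤⇒≡ (false ∷ x) (false ∷ y) p q = cong (false ∷_) (⊑-∣∣≤⇒≡ x y (λ j → p (suc j)) q)
⊑-∣∣≤⇒≡ (false ∷ x) (true  ∷ y) p q = ⊥-elim (<⇒≱ q (⊑⇒∣∣≤ x y (λ j → p (suc j))))
⊑-∣∣≤⇒≡ (true  ∷ x) (false ∷ y) p q = ⊥-elim (not-¬ (p zero refl) refl)
⊑-∣∣≤⇒≡ (true  ∷ x) (true  ∷ y) p (s≤s q) = cong (true ∷_) (⊑-∣∣≤⇒≡ x y (λ j → p (suc j)) q)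

Near-∷ : ∀ {n} b {x y : Vec Bool n} → Near x y → Near (b ∷ x) (b ∷ y)
Near-∷ b = Near-++ˡ (b ∷ [])

⊑-∣∣≤suc⇒Near : ∀ {n} (x y : Vec Bool n) → x ⊑ y → ∣ y ∣ ≤ suc ∣ x ∣ → Near x y
⊑-∣∣≤suc⇒Near [] [] p q = same refl
⊑-∣∣≤suc⇒Near (false ∷ x) (false ∷ y) p q = Near-∷ false (⊑-∣∣≤suc⇒Near x y (λ j → p (suc j)) q)
⊑-∣∣≤suc⇒Near (false ∷ x) (true  ∷ y) p (s≤s q) with ⊑-∣∣≤⇒≡ x y (λ j → p (suc j)) q
... | refl = below here
⊑-∣∣≤suc⇒Near (true  ∷ x) (false ∷ y) p q = ⊥-elim (not-¬ (p zero refl) refl)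
⊑-∣∣≤suc⇒Near (true  ∷ x) (true  ∷ y) p (s≤s q) = Near-∷ true (⊑-∣∣≤suc⇒Near x y (λ j → p (suc j)) q)

⋖⇒⊑ : ∀ {n} {x y : Vec Bool n} → x ⋖ y → x ⊑ y
⋖⇒⊑ here      (suc j) e = e
⋖⇒⊑ (there p) zero    e = e
⋖⇒⊑ (there p) (suc j) e = ⋖⇒⊑ p j e

Near⇒⊑ : ∀ {n} {x y : Vec Bool n} → Near x y → x ⊑ y
Near⇒⊑ (same refl) j e = e
Near⇒⊑ (below p)       = ⋖⇒⊑ p

⋖⇒∣∣ : ∀ {n} {x y : Vec Bool n} → x ⋖ y → ∣ y ∣ ≡ suc ∣ x ∣
⋖⇒∣∣ here                  = refl
⋖⇒∣∣ (there {b = false} p) = ⋖⇒∣∣ p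
⋖⇒∣∣ (there {b = true}  p) = cong suc (⋖⇒∣∣ p)

Near⇒∣∣≤ : ∀ {n} {x y : Vec Bool n} → Near x y → ∣ y ∣ ≤ suc ∣ x ∣
Near⇒∣∣≤ (same refl) = n≤1+n _
Near⇒∣∣≤ (below p)   = ≤-reflexive (⋖⇒∣∣ p)

⋖⇒lowered : ∀ {n} {x y : Vec Bool n} → x ⋖ y → ∃ λ k → lookup y k ≡ true × x ≡ y [ k ]≔ false
⋖⇒lowered here = zero , refl , refl
⋖⇒lowered (there p) with ⋖⇒lowered p
... | k , yk , refl = suc k , yk , refl

cube : ∀ n → List (Vec Bool n)
cube zero    = [] ∷ []
cube (suc n) = cartesianProductWith _∷_ (false ∷ true ∷ []) (cube n)

∈-cube : ∀ {n} (x : Vec Bool n) → x ∈ cube n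
∈-cube []          = here refl
∈-cube (false ∷ x) = ∈-cartesianProductWith⁺ _∷_ {xs = false ∷ true ∷ []} (here refl) (∈-cube x)
∈-cube (true  ∷ x) = ∈-cartesianProductWith⁺ _∷_ {xs = false ∷ true ∷ []} (there (here refl)) (∈-cube x)

length-cube : ∀ n → length (cube n) ≡ 2 ^ n
length-cube zero    = refl
length-cube (suc n) = trans (length-cartesianProductWith _∷_ (false ∷ true ∷ []) (cube n)) (cong (2 *_) (length-cube n))

facet : ∀ {n} → Fin n → List (Vec Bool n)
facet {suc n} j = map (λ u → insertAt u j true) (cube n)

∈-facet : ∀ {n} (u : Vec Bool n) j → lookup u j ≡ true → u ∈ facet j
∈-facet {suc n} u j uj = subst (_∈ facet j)
  (trans (cong (insertAt (removeAt u j) j) (sym uj)) (insertAt-removeAt u j))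
  (∈-map⁺ (λ u → insertAt u j true) (∈-cube (removeAt u j)))

length-facet : ∀ {n} (j : Fin n) → 2 * length (facet j) ≡ 2 ^ n
length-facet {suc n} j = cong (2 *_) (trans (length-map _ (cube n)) (length-cube n))

Covers : ∀ {n} → List (Vec Bool n) → Set
Covers {n} C = ∀ x → ∃ λ y → y ∈ C × Near x y

-- Syndromes and the Hamming-type code

infixl 6 _⊕_
_⊕_ : ∀ {n} → Vec Bool n → Vec Bool n → Vec Bool n
_⊕_ = zipWith _xor_

⊕-assoc : ∀ {n} (x y z : Vec Bool n) → (x ⊕ y) ⊕ z ≡ x ⊕ (y ⊕ z)
⊕-assoc = zipWith-assoc xor-assoc

⊕-comm : ∀ {n} (x y : Vec Bool n) → x ⊕ y ≡ y ⊕ x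
⊕-comm = zipWith-comm xor-comm

⊕-cancelˡ : ∀ {n} (x y : Vec Bool n) → x ⊕ (x ⊕ y) ≡ y
⊕-cancelˡ []      []      = refl
⊕-cancelˡ (a ∷ x) (b ∷ y) = cong₂ _∷_
  (trans (sym (xor-assoc a a b)) (cong (_xor b) (xor-same a))) (⊕-cancelˡ x y)

flip : ∀ {n} → Fin n → Vec Bool n → Vec Bool n
flip j d = updateAt d j not

⋖-flip : ∀ {n} (u : Vec Bool n) j → lookup u j ≡ false → u ⋖ flip j u
⋖-flip (false ∷ u) zero    refl = here
⋖-flip (b ∷ u)     (suc j) eq   = there (⋖-flip u j eq)

flip-⊕ˡ : ∀ {n} j (u v : Vec Bool n) → flip j u ⊕ v ≡ flip j (u ⊕ v)
flip-⊕ˡ zero    (a ∷ u) (b ∷ v) = cong (_∷ _) (sym (not-distribˡ-xor a b))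
flip-⊕ˡ (suc j) (a ∷ u) (b ∷ v) = cong (_ ∷_) (flip-⊕ˡ j u v)

flip-⊕ʳ : ∀ {n} j (u v : Vec Bool n) → u ⊕ flip j v ≡ flip j (u ⊕ v)
flip-⊕ʳ zero    (a ∷ u) (b ∷ v) = cong (_∷ _) (sym (not-distribʳ-xor a b))
flip-⊕ʳ (suc j) (a ∷ u) (b ∷ v) = cong (_ ∷_) (flip-⊕ʳ j u v)

-- The linear map over the two-element field whose parity check matrix has the columns `ls`.
syndrome : ∀ {m} (ls : List (Vec Bool m)) → Vec Bool (length ls) → Vec Bool m
syndrome []       []          = replicate _ false
syndrome (l ∷ ls) (true  ∷ d) = l ⊕ syndrome ls d
syndrome (l ∷ ls) (false ∷ d) = syndrome ls d

-- By linearity a flip adds one column; removing a column is the same as adding it once more.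
syndrome-flip : ∀ {m} (ls : List (Vec Bool m)) j d →
  syndrome ls (flip j d) ≡ List.lookup ls j ⊕ syndrome ls d
syndrome-flip (l ∷ ls) zero    (true  ∷ d) = sym (⊕-cancelˡ l (syndrome ls d))
syndrome-flip (l ∷ ls) zero    (false ∷ d) = refl
syndrome-flip (l ∷ ls) (suc j) (true  ∷ d) = begin
  l ⊕ syndrome ls (flip j d)       ≡⟨ cong (l ⊕_) (syndrome-flip ls j d) ⟩
  l ⊕ (k ⊕ syndrome ls d)          ≡⟨ ⊕-assoc l k _ ⟨
  (l ⊕ k) ⊕ syndrome ls d          ≡⟨ cong (_⊕ syndrome ls d) (⊕-comm l k) ⟩
  (k ⊕ l) ⊕ syndrome ls d          ≡⟨ ⊕-assoc k l _ ⟩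
  k ⊕ (l ⊕ syndrome ls d)          ∎
  where
  open ≡-Reasoning
  k = List.lookup ls j
syndrome-flip (l ∷ ls) (suc j) (false ∷ d) = syndrome-flip ls j d

-- A word t ++ u ++ v ++ w is in the code when t is the syndrome of d = u ⊕ v ⊕ w.  To reach the code
-- from an arbitrary word, the entry of u or of v at the position read off from t and d has to be raised.
-- This fails only if both are already true.  For given t and d, u and v remain free (w is then
-- determined), so exactly a quarter of all words are exceptions.
module Gadget (m : ℕ) where

  -- Unlike in the usual Hamming code the zero column is included, so every discrepancy, even zero,
  -- is repaired by exactly one flip.
  labels : List (Vec Bool m)
  labels = cube m

  L width : ℕ
  L     = length labels
  width = m + (L + (L + L))

  join : Vec Bool m → Vec Bool L → Vec Bool L → Vec Bool L → Vec Bool width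
  join t u v w = t Vec.++ (u Vec.++ (v Vec.++ w))

  join-surjective : ∀ x → ∃ λ t → ∃ λ u → ∃ λ v → ∃ λ w → x ≡ join t u v w
  join-surjective x with splitAt m x
  ... | t , x₁ , refl with splitAt L x₁
  ... | u , x₂ , refl with splitAt L x₂
  ... | v , w , refl = t , u , v , w , refl

  -- A flip adds its column to the syndrome, so the column to look for is the discrepancy between
  -- `t` and the syndrome of `d`.
  position : Vec Bool m → Vec Bool L → Fin L
  position t d = index (∈-cube (t ⊕ syndrome labels d))

  syndrome-position : ∀ t d → syndrome labels (flip (position t d) d) ≡ t
  syndrome-position t d = begin
    syndrome labels (flip (position t d) d)            ≡⟨ syndrome-flip labels (position t d) d ⟩
    List.lookup labels (position t d) ⊕ σ              ≡⟨ cong (_⊕ σ) (sym (lookup-index (∈-cube (t ⊕ σ)))) ⟩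
    (t ⊕ σ) ⊕ σ                                        ≡⟨ ⊕-comm (t ⊕ σ) σ ⟩
    σ ⊕ (t ⊕ σ)                                        ≡⟨ cong (σ ⊕_) (⊕-comm t σ) ⟩
    σ ⊕ (σ ⊕ t)                                        ≡⟨ ⊕-cancelˡ σ t ⟩
    t                                                  ∎
    where
    open ≡-Reasoning
    σ = syndrome labels d

  word : Vec Bool L → Vec Bool L × Vec Bool L → Vec Bool width
  word u (v , w) = join (syndrome labels (u ⊕ (v ⊕ w))) u v w

  words : List (Vec Bool width)
  words = cartesianProductWith word (cube L) (cartesianProductWith _,_ (cube L) (cube L))

  ∈-words : ∀ {t} u v w → syndrome labels (u ⊕ (v ⊕ w)) ≡ t → join t u v w ∈ words
  ∈-words u v w refl = ∈-cartesianProductWith⁺ word (∈-cube u) (∈-cartesianProductWith⁺ _,_ (∈-cube v) (∈-cube w))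

  -- The last part is the unique `w` with `u ⊕ (v ⊕ w) ≡ d`.
  exceptionsAt : Vec Bool m × Vec Bool L → List (Vec Bool width)
  exceptionsAt (t , d) =
    cartesianProductWith (λ u v → join t u v (v ⊕ (u ⊕ d))) (facet (position t d)) (facet (position t d))

  exceptions : List (Vec Bool width)
  exceptions = concatMap exceptionsAt (cartesianProductWith _,_ (cube m) (cube L))

  ∈-exceptions : ∀ t u v w → let j = position t (u ⊕ (v ⊕ w)) in
    lookup u j ≡ true → lookup v j ≡ true → join t u v w ∈ exceptions
  ∈-exceptions t u v w uj vj = ∈-concatMap⁺ exceptionsAt
    (lose (∈-cartesianProductWith⁺ _,_ (∈-cube t) (∈-cube d))
      (subst (λ w' → join t u v w' ∈ exceptionsAt (t , d)) recover
        (∈-cartesianProductWith⁺ (λ u v → join t u v (v ⊕ (u ⊕ d))) (∈-facet u _ uj) (∈-facet v _ vj))))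
    where
    d = u ⊕ (v ⊕ w)
    recover : v ⊕ (u ⊕ d) ≡ w
    recover = trans (cong (v ⊕_) (⊕-cancelˡ u (v ⊕ w))) (⊕-cancelˡ v w)

  cover : ∀ x → (∃ λ y → y ∈ words × Near x y) ⊎ x ∈ exceptions
  cover x with join-surjective x
  ... | t , u , v , w , refl = byCases (lookup u j) (lookup v j) refl refl
    where
    d = u ⊕ (v ⊕ w)
    j = position t d
    byCases : ∀ a b → lookup u j ≡ a → lookup v j ≡ b →
      (∃ λ y → y ∈ words × Near (join t u v w) y) ⊎ join t u v w ∈ exceptions
    -- Raising entry `j` of `u` flips exactly entry `j` of `d`, which makes the syndrome equal to
    -- `t`.
    byCases false b uj vj = inj₁ (join t (flip j u) v w ,
      ∈-words (flip j u) v w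
        (trans (cong (syndrome labels) (flip-⊕ˡ j u (v ⊕ w))) (syndrome-position t d)) ,
      below (⋖-++ˡ t (⋖-++ʳ (v Vec.++ w) (⋖-flip u j uj))))
    byCases true false uj vj = inj₁ (join t u (flip j v) w ,
      ∈-words u (flip j v) w
        (trans (cong (syndrome labels) (trans (cong (u ⊕_) (flip-⊕ˡ j v w)) (flip-⊕ʳ j u (v ⊕ w))))
          (syndrome-position t d)) ,
      below (⋖-++ˡ t (⋖-++ˡ u (⋖-++ʳ w (⋖-flip v j vj)))))
    byCases true true uj vj = inj₂ (∈-exceptions t u v w uj vj)

  2^width : 2 ^ width ≡ 2 ^ m * (2 ^ L * (2 ^ L * 2 ^ L))
  2^width = trans (^-distribˡ-+-* 2 m (L + (L + L))) (cong (2 ^ m *_)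
    (trans (^-distribˡ-+-* 2 L (L + L)) (cong (2 ^ L *_) (^-distribˡ-+-* 2 L L))))

  -- The part `t` is determined by the other three, so one word in `2 ^ m` is a code word.
  length-words : length words * 2 ^ m ≡ 2 ^ width
  length-words = begin
    length words * 2 ^ m                    ≡⟨ cong (_* 2 ^ m) eq ⟩
    2 ^ L * (2 ^ L * 2 ^ L) * 2 ^ m         ≡⟨ *-comm (2 ^ L * (2 ^ L * 2 ^ L)) (2 ^ m) ⟩
    2 ^ m * (2 ^ L * (2 ^ L * 2 ^ L))       ≡⟨ 2^width ⟨
    2 ^ width                               ∎
    where
    open ≡-Reasoning
    eq : length words ≡ 2 ^ L * (2 ^ L * 2 ^ L)
    eq = trans (length-cartesianProductWith word (cube L) _)
      (cong₂ _*_ (length-cube L) (trans (length-cartesianProductWith _,_ (cube L) (cube L))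
        (cong₂ _*_ (length-cube L) (length-cube L))))

  length-exceptions : 4 * length exceptions ≡ 2 ^ width
  length-exceptions = begin
    4 * length exceptions                             ≡⟨ length-concatMap 4 exceptionsAt size pairs ⟩
    length pairs * (2 ^ L * 2 ^ L)                    ≡⟨ cong (_* (2 ^ L * 2 ^ L)) eq ⟩
    2 ^ m * 2 ^ L * (2 ^ L * 2 ^ L)                   ≡⟨ *-assoc (2 ^ m) (2 ^ L) _ ⟩
    2 ^ m * (2 ^ L * (2 ^ L * 2 ^ L))                 ≡⟨ 2^width ⟨
    2 ^ width                                         ∎
    where
    open ≡-Reasoning
    pairs = cartesianProductWith _,_ (cube m) (cube L)
    eq : length pairs ≡ 2 ^ m * 2 ^ L
    eq = trans (length-cartesianProductWith _,_ (cube m) (cube L)) (cong₂ _*_ (length-cube m) (length-cube L))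
    four : ∀ a b → 4 * (a * b) ≡ (2 * a) * (2 * b)
    four = solve-∀
    -- Each of the two facets is half a cube, whence the factor 4.
    size : ∀ td → 4 * length (exceptionsAt td) ≡ 2 ^ L * 2 ^ L
    size (t , d) = trans (cong (4 *_) (length-cartesianProductWith _ (facet j) (facet j)))
      (trans (four (length (facet j)) (length (facet j))) (cong₂ _*_ (length-facet j) (length-facet j)))
      where j = position t d

-- The recursive code and its density

codeLength : ℕ → ℕ
codeLength zero    = 0
codeLength (suc m) = Gadget.width (suc m) + codeLength m

-- Where the gadget covers the first part, the rest stays arbitrary. An exceptional first part is
-- kept unchanged, and the one entry that may be raised is left to the smaller code.
code : ∀ m → List (Vec Bool (codeLength m))
code zero    = [] ∷ []
code (suc m) = cartesianProductWith Vec._++_ words (cube (codeLength m)) ++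
               cartesianProductWith Vec._++_ exceptions (code m)
  where open Gadget (suc m)

code-covers : ∀ m → Covers (code m)
code-covers zero [] = [] , here refl , same refl
code-covers (suc m) x with splitAt (Gadget.width (suc m)) x
... | a , r , refl with Gadget.cover (suc m) a
... | inj₁ (b , b∈ , near) = b Vec.++ r , ∈-++⁺ˡ (∈-cartesianProductWith⁺ Vec._++_ b∈ (∈-cube r)) , Near-++ʳ r near
... | inj₂ a∈ with code-covers m r
... | s , s∈ , near = a Vec.++ s ,
  ∈-++⁺ʳ (cartesianProductWith Vec._++_ (Gadget.words (suc m)) (cube (codeLength m)))
    (∈-cartesianProductWith⁺ Vec._++_ a∈ s∈) ,
  Near-++ˡ a near

-- If the density is `d / 2 ^ m`, the next one is `(1 + d / 2) / 2 ^ (suc m)`: the gadget words give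
-- 1, and the quarter of exceptions gives `d / 2`. The constant 2 is the fixed point.
code-sparse : ∀ m → length (code m) * 2 ^ m ≤ 2 * 2 ^ codeLength m
code-sparse zero    = s≤s z≤n
code-sparse (suc m) = begin
  length (code (suc m)) * (2 * M)         ≡⟨ cong (_* (2 * M)) len ⟩
  (W * R + E * K) * (2 * M)               ≡⟨ rearrange W R E K M ⟩
  W * (2 * M) * R + 2 * E * (K * M)       ≤⟨ +-monoʳ-≤ (W * (2 * M) * R) (*-monoʳ-≤ (2 * E) (code-sparse m)) ⟩
  W * (2 * M) * R + 2 * E * (2 * R)       ≡⟨ cong (W * (2 * M) * R +_) (quadruple E R) ⟩
  W * (2 * M) * R + 4 * E * R             ≡⟨ cong₂ (λ a b → a * R + b * R) length-words length-exceptions ⟩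
  2 ^ width * R + 2 ^ width * R           ≡⟨ double (2 ^ width) R ⟩
  2 * (2 ^ width * R)                     ≡⟨ cong (2 *_) (^-distribˡ-+-* 2 width (codeLength m)) ⟨
  2 * 2 ^ codeLength (suc m)              ∎
  where
  open ≤-Reasoning
  open Gadget (suc m)
  W = length words
  E = length exceptions
  K = length (code m)
  R = 2 ^ codeLength m
  M = 2 ^ m
  len : length (code (suc m)) ≡ W * R + E * K
  len = trans (length-++ (cartesianProductWith Vec._++_ words (cube (codeLength m))))
    (cong₂ _+_
      (trans (length-cartesianProductWith Vec._++_ words _) (cong (W *_) (length-cube (codeLength m))))
      (length-cartesianProductWith Vec._++_ exceptions (code m)))
  rearrange : ∀ w r e k m → (w * r + e * k) * (2 * m) ≡ w * (2 * m) * r + 2 * e * (k * m)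
  rearrange = solve-∀
  quadruple : ∀ e r → 2 * e * (2 * r) ≡ 4 * e * r
  quadruple = solve-∀
  double : ∀ a r → a * r + a * r ≡ 2 * (a * r)
  double = solve-∀

n<2^n : ∀ n → n < 2 ^ n
n<2^n zero    = s≤s z≤n
n<2^n (suc n) = begin-strict
  suc n              <⟨ s≤s (n<2^n n) ⟩
  suc (2 ^ n)        ≤⟨ +-monoˡ-≤ (2 ^ n) (m^n>0 2 n) ⟩
  2 ^ n + 2 ^ n      ≡⟨ cong (2 ^ n +_) (+-identityʳ (2 ^ n)) ⟨
  2 ^ suc n          ∎
  where open ≤-Reasoning

-- The new gadget has at most four parts of size `2 * M`, counting `suc m` as one of them; together
-- with `8 * M` this is again `8 * (2 * M)`.
codeLength-≤ : ∀ m → codeLength m ≤ 8 * 2 ^ m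
codeLength-≤ zero    = z≤n
codeLength-≤ (suc m) = begin
  suc m + (L + (L + L)) + codeLength m     ≤⟨ +-mono-≤ (+-monoˡ-≤ (L + (L + L)) (<⇒≤ (n<2^n (suc m)))) (codeLength-≤ m) ⟩
  2 * M + (L + (L + L)) + 8 * M            ≡⟨ cong (λ l → 2 * M + (l + (l + l)) + 8 * M) (length-cube (suc m)) ⟩
  2 * M + (2 * M + (2 * M + 2 * M)) + 8 * M ≡⟨ total M ⟩
  8 * (2 * M)                              ∎
  where
  open ≤-Reasoning
  open Gadget (suc m) using (L)
  M = 2 ^ m
  total : ∀ a → 2 * a + (2 * a + (2 * a + 2 * a)) + 8 * a ≡ 8 * (2 * a)
  total = solve-∀

-- Selects the largest code that fits into `n` coordinates.
bracket : ∀ n → ∃ λ m → codeLength m ≤ n × n < codeLength (suc m)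
bracket zero = 0 , z≤n , s≤s z≤n
bracket (suc n) with bracket n
... | m , lo , hi with codeLength (suc m) ≤? suc n
... | no ¬p = m , m≤n⇒m≤1+n lo , ≰⇒> ¬p
-- The gadget of the following code has at least one coordinate, so its length exceeds `suc n`.
... | yes p = suc m , p , ≤-trans (s≤s hi) (s≤s (m≤n+m (codeLength (suc m)) (suc m + _)))

-- Surplus coordinates are left free. The first bound pays for the part of a block linear in `n`,
-- the second for its constant part.
sparseCover : ∀ n → ∃ λ (C : List (Vec Bool n)) → Covers C × length C * n ≤ 32 * 2 ^ n × length C ≤ 2 * 2 ^ n
sparseCover n with bracket n
... | m , lo , hi with m≤n⇒∃[o]m+o≡n lo
... | k , refl = C , covers , dense , small
  where
  C = cartesianProductWith Vec._++_ (code m) (cube k)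
  covers : Covers C
  covers x with splitAt (codeLength m) x
  ... | a , r , refl with code-covers m a
  ... | b , b∈ , near = b Vec.++ r , ∈-cartesianProductWith⁺ Vec._++_ b∈ (∈-cube r) , Near-++ʳ r near
  K = length (code m)
  len : length C ≡ K * 2 ^ k
  len = trans (length-cartesianProductWith Vec._++_ (code m) (cube k)) (cong (K *_) (length-cube k))
  open ≤-Reasoning
  scaled : K * 2 ^ k * 2 ^ m ≤ 2 * 2 ^ (codeLength m + k)
  scaled = begin
    K * 2 ^ k * 2 ^ m                  ≡⟨ swap K (2 ^ k) (2 ^ m) ⟩
    K * 2 ^ m * 2 ^ k                  ≤⟨ *-monoˡ-≤ (2 ^ k) (code-sparse m) ⟩
    2 * 2 ^ codeLength m * 2 ^ k       ≡⟨ *-assoc 2 (2 ^ codeLength m) (2 ^ k) ⟩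
    2 * (2 ^ codeLength m * 2 ^ k)     ≡⟨ cong (2 *_) (^-distribˡ-+-* 2 (codeLength m) k) ⟨
    2 * 2 ^ (codeLength m + k)         ∎
    where
    swap : ∀ a b c → a * b * c ≡ a * c * b
    swap = solve-∀
  small : length C ≤ 2 * 2 ^ (codeLength m + k)
  small = begin
    length C                    ≡⟨ len ⟩
    K * 2 ^ k                   ≤⟨ m≤m*n (K * 2 ^ k) (2 ^ m) {{m^n≢0 2 m}} ⟩
    K * 2 ^ k * 2 ^ m           ≤⟨ scaled ⟩
    2 * 2 ^ (codeLength m + k)  ∎
  -- The next code is too long for `n`, so `n` is at most `16 * 2 ^ m`, which the density of the
  -- code compensates.
  dense : length C * (codeLength m + k) ≤ 32 * 2 ^ (codeLength m + k)
  dense = begin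
    length C * (codeLength m + k)       ≤⟨ *-monoʳ-≤ (length C) (≤-trans (<⇒≤ hi) (codeLength-≤ (suc m))) ⟩
    length C * (8 * (2 * 2 ^ m))        ≡⟨ cong (_* (8 * (2 * 2 ^ m))) len ⟩
    K * 2 ^ k * (8 * (2 * 2 ^ m))       ≡⟨ pull (K * 2 ^ k) (2 ^ m) ⟩
    16 * (K * 2 ^ k * 2 ^ m)            ≤⟨ *-monoʳ-≤ 16 scaled ⟩
    16 * (2 * 2 ^ (codeLength m + k))   ≡⟨ *-assoc 16 2 (2 ^ (codeLength m + k)) ⟨
    32 * 2 ^ (codeLength m + k)         ∎
    where
    pull : ∀ a b → a * (8 * (2 * b)) ≡ 16 * (a * b)
    pull = solve-∀

-- Programs that carry one bit in the offset at which a block is entered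

Halts : ∀ {n} → InstrSeq → Vec Bool n → ℕ → State → Bool → Set
Halts X x pc s v = ∃ λ fuel → ∃ λ s' → run fuel X x pc s ≡ terminated s' × out s' ≡ v

-- No jump goes backwards, so execution depends only on the remaining suffix.
run-∷ : ∀ {n} (x : Vec Bool n) u X fuel pc s → run fuel (u ∷ X) x (suc pc) s ≡ run fuel X x pc s
run-∷ x u X zero pc s = refl
run-∷ x u X (suc fuel) pc s with lookupInstr X pc
... | nothing = refl
... | just halt = refl
... | just (jump zero) = refl
... | just (jump (suc l)) = run-∷ x u X fuel (pc + suc l) s
... | just (plain a) with execBasic x s a
...   | nothing = refl
...   | just (_ , s') = run-∷ x u X fuel (suc pc) s'
run-∷ x u X (suc fuel) pc s | just (ptest a) with execBasic x s a
...   | nothing = refl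
...   | just (true , s') = run-∷ x u X fuel (suc pc) s'
...   | just (false , s') = run-∷ x u X fuel (suc (suc pc)) s'
run-∷ x u X (suc fuel) pc s | just (ntest a) with execBasic x s a
...   | nothing = refl
...   | just (true , s') = run-∷ x u X fuel (suc (suc pc)) s'
...   | just (false , s') = run-∷ x u X fuel (suc pc) s'

execBasic-inGet : ∀ {n} (x : Vec Bool n) s (j : Fin n) →
  execBasic x s (inGet (toℕ j)) ≡ just (lookup x j , s)
execBasic-inGet {n} x s j with toℕ j <? n
... | yes p = cong (λ i → just (lookup x i , s)) (fromℕ<-toℕ j p)
... | no ¬p = ⊥-elim (¬p (toℕ<n j))

-- Proceeds with the next instruction if in:(j+1) contains b and skips it otherwise.
testIn : ∀ {n} → Fin n → Bool → Instr
testIn j true  = ptest (inGet (toℕ j))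
testIn j false = ntest (inGet (toℕ j))

module _ {n : ℕ} {x : Vec Bool n} {s : State} {v : Bool} where

  Halts-∷ : ∀ {u X pc} → Halts X x pc s v → Halts (u ∷ X) x (suc pc) s v
  Halts-∷ {u} {X} {pc} (fuel , s' , e , o) = fuel , s' , trans (run-∷ x u X fuel pc s) e , o

  Halts-jump2 : ∀ {X} → Halts X x 1 s v → Halts (jump 2 ∷ X) x 0 s v
  Halts-jump2 h with Halts-∷ {u = jump 2} h
  ... | fuel , s' , e , o = suc fuel , s' , e , o

  Halts-test-hit : ∀ {X} j b → lookup x j ≡ b → Halts X x 0 s v → Halts (testIn j b ∷ X) x 0 s v
  Halts-test-hit {X} j b eq h with Halts-∷ {u = testIn j b} h
  ... | fuel , s' , e , o = suc fuel , s' , trans (step b eq) e , o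
    where
    step : ∀ b → lookup x j ≡ b → run (suc fuel) (testIn j b ∷ X) x 0 s ≡ run fuel (testIn j b ∷ X) x 1 s
    step true  eq rewrite execBasic-inGet x s j | eq = refl
    step false eq rewrite execBasic-inGet x s j | eq = refl

  Halts-test-miss : ∀ {X} j b → lookup x j ≡ not b → Halts X x 1 s v → Halts (testIn j b ∷ X) x 0 s v
  Halts-test-miss {X} j b eq h with Halts-∷ {u = testIn j b} h
  ... | fuel , s' , e , o = suc fuel , s' , trans (step b eq) e , o
    where
    step : ∀ b → lookup x j ≡ not b → run (suc fuel) (testIn j b ∷ X) x 0 s ≡ run fuel (testIn j b ∷ X) x 2 s
    step true  eq rewrite execBasic-inGet x s j | eq = refl
    step false eq rewrite execBasic-inGet x s j | eq = refl

-- Entering a block at its first instruction thus means starting with the bit `true`.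
offset : Bool → ℕ
offset true  = 0
offset false = 1

-- The rule (j , b , c) overwrites the stored bit by c if in:(j+1) contains b.
Rule : ℕ → Set
Rule n = Fin n × Bool × Bool

Fires : ∀ {n} → Vec Bool n → Rule n → Set
Fires x (j , b , _) = lookup x j ≡ b

result : ∀ {n} → Rule n → Bool
result (_ , _ , c) = c

-- If the stored bit equals the bit to be written, execution enters at the jump, which preserves the
-- offset. Otherwise it enters at the test, and a hit changes the offset while a miss keeps it.
ruleCode : ∀ {n} → Rule n → InstrSeq
ruleCode (j , b , false) = testIn j b ∷ jump 2 ∷ []
ruleCode (j , b , true)  = jump 2 ∷ testIn j b ∷ []

rulesCode : ∀ {n} → List (Rule n) → InstrSeq
rulesCode = concatMap ruleCode

applyRule : ∀ {n} → Vec Bool n → Bool → Rule n → Bool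
applyRule x b (j , d , c) = if does (lookup x j ≟ d) then c else b

applyRules : ∀ {n} → Vec Bool n → Bool → List (Rule n) → Bool
applyRules x b []       = b
applyRules x b (r ∷ rs) = applyRules x (applyRule x b r) rs

applyRules-++ : ∀ {n} (x : Vec Bool n) b rs rs' →
  applyRules x b (rs ++ rs') ≡ applyRules x (applyRules x b rs) rs'
applyRules-++ x b []       rs' = refl
applyRules-++ x b (r ∷ rs) rs' = applyRules-++ x (applyRule x b r) rs rs'

applyRules-stable : ∀ {n} (x : Vec Bool n) b rs →
  (∀ {r} → r ∈ rs → Fires x r → result r ≡ b) → applyRules x b rs ≡ b
applyRules-stable x b [] h = refl
applyRules-stable x b ((j , d , c) ∷ rs) h with lookup x j ≟ d
... | no _  = applyRules-stable x b rs (λ r∈ → h (there r∈))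
... | yes e rewrite h (here refl) e = applyRules-stable x b rs (λ r∈ → h (there r∈))

-- Once some rule has fired the initial bit is forgotten, and later firing rules write `c` again.
applyRules-const : ∀ {n} (x : Vec Bool n) b c {r} rs → r ∈ rs → Fires x r →
  (∀ {r'} → r' ∈ rs → Fires x r' → result r' ≡ c) → applyRules x b rs ≡ c
applyRules-const x b c ((j , d , c') ∷ rs) (here refl) f h with lookup x j ≟ d
... | no ¬f = ⊥-elim (¬f f)
... | yes e rewrite h (here refl) e = applyRules-stable x c rs (λ r∈ → h (there r∈))
applyRules-const x b c (r' ∷ rs) (there r∈) f h =
  applyRules-const x (applyRule x b r') c rs r∈ f (λ r∈ → h (there r∈))

module _ {n : ℕ} {x : Vec Bool n} {s : State} {v : Bool} where

  Halts-rule : ∀ {X} b r → Halts X x (offset (applyRule x b r)) s v →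
    Halts (ruleCode r ++ X) x (offset b) s v
  Halts-rule {X} b (j , d , c) h with lookup x j ≟ d
  -- The stored bit is already the one to be written, so both branches of `applyRule` agree.
  Halts-rule {X} true (j , d , true) h | e? =
    Halts-jump2 (Halts-∷ (subst (λ b → Halts X x (offset b) s v) (if-eta (does e?)) h))
  Halts-rule true  (j , d , false) h | yes e = Halts-test-hit j d e (Halts-jump2 h)
  Halts-rule true  (j , d , false) h | no ne = Halts-test-miss j d (¬-not ne) (Halts-∷ h)
  Halts-rule false (j , d , true)  h | yes e = Halts-∷ (Halts-test-hit j d e h)
  Halts-rule false (j , d , true)  h | no ne = Halts-∷ (Halts-test-miss j d (¬-not ne) h)
  Halts-rule {X} false (j , d , false) h | e? =
    Halts-∷ (Halts-jump2 (subst (λ b → Halts X x (offset b) s v) (if-eta (does e?)) h))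

  Halts-rules : ∀ {X} b rs → Halts X x (offset (applyRules x b rs)) s v →
    Halts (rulesCode rs ++ X) x (offset b) s v
  Halts-rules b [] h = h
  Halts-rules {X} b (r ∷ rs) h rewrite ++-assoc (ruleCode r) (rulesCode rs) X =
    Halts-rule b r (Halts-rules (applyRule x b r) rs h)

-- The sign of the test is such that the reply of the write always causes a skip, here over `jump 2`
-- to `halt`.
setOut : Bool → Instr
setOut true  = ntest (outSet true)
setOut false = ptest (outSet false)

-- If the stored bit is true, halts with out = v; otherwise falls through with the bit reset to true.
haltIf : Bool → InstrSeq
haltIf v = setOut v ∷ jump 2 ∷ halt ∷ []

haltIf-true : ∀ {n} (x : Vec Bool n) s v X → Halts (haltIf v ++ X) x (offset true) s v
haltIf-true x s true  X = 2 , _ , refl , refl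
haltIf-true x s false X = 2 , _ , refl , refl

haltIf-false : ∀ {n} {x : Vec Bool n} {s v} w {X} → Halts X x 0 s v →
  Halts (haltIf w ++ X) x (offset false) s v
haltIf-false w h = Halts-∷ (Halts-jump2 (Halts-∷ h))

-- Segments, which compare the input with a fixed vector

module _ {n : ℕ} (y : Vec Bool n) where

  ones zeros : List (Fin n)
  ones  = filter (λ j → lookup y j ≟ true) (allFin n)
  zeros = filter (λ j → lookup y j ≟ false) (allFin n)

  -- The second pass erases the effect of the first unless x ⊑ y.
  segmentRules : (Fin n → Bool) → List (Rule n)
  segmentRules g = map (λ j → j , false , g j) ones ++ map (λ j → j , true , false) zeros

  onesRules-only : ∀ (g : Fin n → Bool) {r : Rule n} → r ∈ map (λ j → j , false , g j) ones →
    ∃ λ j → lookup y j ≡ true × r ≡ (j , false , g j)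
  onesRules-only g r∈ with ∈-map⁻ _ r∈
  ... | j , j∈ , refl = j , proj₂ (∈-filter⁻ _ {xs = allFin n} j∈) , refl

  zerosRules-only : ∀ {r : Rule n} → r ∈ map (λ j → j , true , false) zeros →
    ∃ λ j → lookup y j ≡ false × r ≡ (j , true , false)
  zerosRules-only r∈ with ∈-map⁻ _ r∈
  ... | j , j∈ , refl = j , proj₂ (∈-filter⁻ _ {xs = allFin n} j∈) , refl

  -- The rule for `k` in the second pass fires, and all rules of that pass write `false`.
  segmentRules-⋢ : ∀ g x b k → lookup x k ≡ true → lookup y k ≡ false →
    applyRules x b (segmentRules g) ≡ false
  segmentRules-⋢ g x b k xk yk =
    trans (applyRules-++ x b (map _ ones) (map _ zeros))
      (applyRules-const x _ false (map _ zeros)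
        (∈-map⁺ (λ j → j , true , false) (∈-filter⁺ (λ j → lookup y j ≟ false) (∈-allFin k) yk)) xk all-false)
    where
    all-false : ∀ {r} → r ∈ map (λ j → j , true , false) zeros → Fires x r → result r ≡ false
    all-false r∈ _ with zerosRules-only r∈
    ... | _ , _ , refl = refl

  segmentRules-⊑ : ∀ g x b → x ⊑ y →
    applyRules x b (segmentRules g) ≡ applyRules x b (map (λ j → j , false , g j) ones)
  segmentRules-⊑ g x b x⊑y =
    trans (applyRules-++ x b (map _ ones) (map _ zeros)) (applyRules-stable x _ (map _ zeros) silent)
    where
    silent : ∀ {r c} → r ∈ map (λ j → j , true , false) zeros → Fires x r → result r ≡ c
    silent r∈ xj with zerosRules-only r∈
    ... | j , yj , refl = ⊥-elim (not-¬ xj (x⊑y j yj))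

  -- The second pass is silent, and the firing rules of the first write `true`. For `x ≡ y` none
  -- fires at all.
  segmentRules-⊑-true : ∀ g x → x ⊑ y →
    (∀ j → lookup y j ≡ true → lookup x j ≡ false → g j ≡ true) →
    applyRules x true (segmentRules g) ≡ true
  segmentRules-⊑-true g x x⊑y h = trans (segmentRules-⊑ g x true x⊑y)
    (applyRules-stable x true (map _ ones) all-true)
    where
    all-true : ∀ {r} → r ∈ map (λ j → j , false , g j) ones → Fires x r → result r ≡ true
    all-true r∈ xj with onesRules-only g r∈
    ... | j , yj , refl = h j yj xj

  -- Among the ones of `y` only position `k` now reads `false`, so exactly its rule fires.
  segmentRules-lower : ∀ g b k → lookup y k ≡ true → applyRules (y [ k ]≔ false) b (segmentRules g) ≡ g k
  segmentRules-lower g b k yk = trans (segmentRules-⊑ g (y [ k ]≔ false) b lowered)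
    (applyRules-const (y [ k ]≔ false) b (g k) (map _ ones)
      (∈-map⁺ (λ j → j , false , g j) (∈-filter⁺ (λ j → lookup y j ≟ true) (∈-allFin k) yk)) (lookup∘update k y false) only-k)
    where
    lowered : (y [ k ]≔ false) ⊑ y
    lowered j yj with j Fin.≟ k
    ... | yes refl = lookup∘update k y false
    ... | no j≢k   = trans (lookup∘update′ j≢k y false) yj
    only-k : ∀ {r} → r ∈ map (λ j → j , false , g j) ones → Fires (y [ k ]≔ false) r → result r ≡ g k
    only-k r∈ xj with onesRules-only g r∈
    ... | j , yj , refl with j Fin.≟ k
    ... | yes refl = refl
    ... | no j≢k   = ⊥-elim (not-¬ xj (trans (lookup∘update′ j≢k y false) yj))

segment : ∀ {n} → Vec Bool n → (Fin n → Bool) → Bool → InstrSeq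
segment y g v = rulesCode (segmentRules y g) ++ haltIf v

segment-halts : ∀ {n} {x : Vec Bool n} {s} y g w {X} →
  applyRules x true (segmentRules y g) ≡ true → Halts (segment y g w ++ X) x 0 s w
segment-halts {x = x} {s} y g w {X} eq
  rewrite ++-assoc (rulesCode (segmentRules y g)) (haltIf w) X =
  Halts-rules true (segmentRules y g)
    (subst (λ b → Halts (haltIf w ++ X) x (offset b) s w) (sym eq) (haltIf-true x s w X))

segment-passes : ∀ {n} {x : Vec Bool n} {s v} y g w {X} →
  applyRules x true (segmentRules y g) ≡ false → Halts X x 0 s v → Halts (segment y g w ++ X) x 0 s v
segment-passes {x = x} {s} {v} y g w {X} eq h
  rewrite ++-assoc (rulesCode (segmentRules y g)) (haltIf w) X =
  Halts-rules true (segmentRules y g)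
    (subst (λ b → Halts (haltIf w ++ X) x (offset b) s v) (sym eq) (haltIf-false w h))

-- The program and its correctness

module Program {n : ℕ} (f : Vec Bool n → Bool) where

  agrees : Vec Bool n → Fin n → Bool
  agrees y k = does (f (y [ k ]≔ false) ≟ f y)

  -- The first segment stops `y` and those lowered neighbours on which `f` takes the value `f y`.
  -- The second stops the remaining neighbours, whose value can only be `not (f y)`.
  block : Vec Bool n → InstrSeq
  block y = segment y (agrees y) (f y) ++ segment y (λ _ → true) (not (f y))

  block-passes : ∀ {x y s v X} k → lookup x k ≡ true → lookup y k ≡ false →
    Halts X x 0 s v → Halts (block y ++ X) x 0 s v
  block-passes {x} {y} {X = X} k xk yk h
    rewrite ++-assoc (segment y (agrees y) (f y)) (segment y (λ _ → true) (not (f y))) X =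
    segment-passes y (agrees y) (f y) (segmentRules-⋢ y (agrees y) x true k xk yk)
      (segment-passes y (λ _ → true) (not (f y)) (segmentRules-⋢ y (λ _ → true) x true k xk yk) h)

  block-halts : ∀ {x y s X} → Near x y → Halts (block y ++ X) x 0 s (f x)
  block-halts {x} {y} {s} {X} near
    rewrite ++-assoc (segment y (agrees y) (f y)) (segment y (λ _ → true) (not (f y))) X = go near
    where
    go : Near x y → Halts (segment y (agrees y) (f y) ++ segment y (λ _ → true) (not (f y)) ++ X) x 0 s (f x)
    go (same refl) = segment-halts y (agrees y) (f y)
      (segmentRules-⊑-true y (agrees y) y (λ _ e → e) (λ j yj yj′ → ⊥-elim (not-¬ yj yj′)))
    go (below p) with ⋖⇒lowered p
    ... | k , yk , refl with f (y [ k ]≔ false) ≟ f y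
    ... | yes e = subst (Halts _ _ 0 s) (sym e) (segment-halts y (agrees y) (f y)
            (trans (segmentRules-lower y (agrees y) true k yk) (dec-true (_ ≟ _) e)))
    ... | no ne = segment-passes y (agrees y) (f y)
            (trans (segmentRules-lower y (agrees y) true k yk) (dec-false (_ ≟ _) ne))
            (subst (Halts _ _ 0 s) (sym (¬-not ne)) (segment-halts y (λ _ → true) (not (f y))
              (segmentRules-lower y (λ _ → true) true k yk)))

  program : List (Vec Bool n) → InstrSeq
  program = concatMap block

  -- The first y above x in the list is no heavier than the one near x, hence is near x itself.
  program-halts : ∀ {x y s} ys → AllPairs (λ a b → ∣ a ∣ ≤ ∣ b ∣) ys → y ∈ ys → Near x y →
    Halts (program ys) x 0 s (f x)
  program-halts {x} (z ∷ ys) (z≤ ∷ sorted) y∈ near with ⊑-or-outside x z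
  program-halts {x} (z ∷ ys) (z≤ ∷ sorted) (here refl) near | inj₁ _ = block-halts near
  program-halts {x} (z ∷ ys) (z≤ ∷ sorted) (there y∈) near | inj₁ x⊑z =
    block-halts (⊑-∣∣≤suc⇒Near x z x⊑z (≤-trans (All.lookup z≤ y∈) (Near⇒∣∣≤ near)))
  program-halts {x} (z ∷ ys) (z≤ ∷ sorted) (here refl) near | inj₂ (k , xk , zk)
    = ⊥-elim (not-¬ xk (Near⇒⊑ near k zk))
  program-halts {x} (z ∷ ys) (z≤ ∷ sorted) (there y∈) near | inj₂ (k , xk , zk) =
    block-passes k xk zk (program-halts ys sorted y∈ near)

-- Length bounds and admissible instructions

length-ruleCode : ∀ {n} (r : Rule n) → length (ruleCode r) ≤ 2
length-ruleCode (_ , _ , true)  = ≤-refl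
length-ruleCode (_ , _ , false) = ≤-refl

-- Ones and zeros partition the positions; bounding each by `n` costs only a constant factor.
length-segmentRules : ∀ {n} (y : Vec Bool n) g → length (segmentRules y g) ≤ n + n
length-segmentRules {n} y g = begin
  length (segmentRules y g)               ≡⟨ length-++ (map _ (ones y)) ⟩
  length (map (λ j → j , false , g j) (ones y)) + length (map (λ j → j , true , false) (zeros y))
                                          ≡⟨ cong₂ _+_ (length-map _ (ones y)) (length-map _ (zeros y)) ⟩
  length (ones y) + length (zeros y)      ≤⟨ +-mono-≤ (length-filter _ (allFin n)) (length-filter _ (allFin n)) ⟩
  length (allFin n) + length (allFin n)   ≡⟨ cong₂ _+_ len len ⟩
  n + n                                   ∎
  where
  open ≤-Reasoning
  len : length (allFin n) ≡ n
  len = length-tabulate (λ j → j)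

length-segment : ∀ {n} (y : Vec Bool n) g v → length (segment y g v) ≤ (n + n) * 2 + 3
length-segment {n} y g v = begin
  length (segment y g v)                              ≡⟨ length-++ (rulesCode (segmentRules y g)) ⟩
  length (rulesCode (segmentRules y g)) + 3           ≤⟨ +-monoˡ-≤ 3 (length-concatMap-≤ ruleCode length-ruleCode (segmentRules y g)) ⟩
  length (segmentRules y g) * 2 + 3                   ≤⟨ +-monoˡ-≤ 3 (*-monoˡ-≤ 2 (length-segmentRules y g)) ⟩
  (n + n) * 2 + 3                                     ∎
  where open ≤-Reasoning

testIn-ok : ∀ {n} (j : Fin n) b → NoAuxOnlyJump2 (testIn j b)
testIn-ok j true  = ptest-ok (inGet-ok _)
testIn-ok j false = ntest-ok (inGet-ok _)

ruleCode-ok : ∀ {n} (r : Rule n) → All NoAuxOnlyJump2 (ruleCode r)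
ruleCode-ok (j , b , true)  = jump2-ok ∷ testIn-ok j b ∷ []
ruleCode-ok (j , b , false) = testIn-ok j b ∷ jump2-ok ∷ []

haltIf-ok : ∀ v → All NoAuxOnlyJump2 (haltIf v)
haltIf-ok true  = ntest-ok (outSet-ok true) ∷ jump2-ok ∷ halt-ok ∷ []
haltIf-ok false = ptest-ok (outSet-ok false) ∷ jump2-ok ∷ halt-ok ∷ []

segment-ok : ∀ {n} (y : Vec Bool n) g v → All NoAuxOnlyJump2 (segment y g v)
segment-ok y g v = ++⁺ (All-concatMap ruleCode ruleCode-ok (segmentRules y g)) (haltIf-ok v)

Computes⇒≢[] : ∀ {n f X} → Computes n X f → X ≢ []
Computes⇒≢[] {n} computes refl with computes (replicate n false)
... | zero , _ , () , _
... | suc _ , _ , () , _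

theorem1 : ∃ λ (c : ℕ) → (n : ℕ) → (f : Vec Bool n → Bool) →
    ∃ λ (X : InstrSeq) → X ≢ [] × All NoAuxOnlyJump2 X × Computes n X f
    × length X ≤ c * 2 ^ n
-- 268 is `8 * 32 + 6 * 2`: blocks have length at most `8 * n + 6`, and 32 and 2 are the constants
-- of `sparseCover`.
theorem1 = 268 , λ n f → construct n f (sparseCover n)
  where
  construct : ∀ n (f : Vec Bool n → Bool) →
    (∃ λ (C : List (Vec Bool n)) → Covers C × length C * n ≤ 32 * 2 ^ n × length C ≤ 2 * 2 ^ n) →
    ∃ λ (X : InstrSeq) → X ≢ [] × All NoAuxOnlyJump2 X × Computes n X f × length X ≤ 268 * 2 ^ n
  construct n f (C , covers , dense , small) =
    program ys , Computes⇒≢[] computes , allowed , computes , short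
    where
    open Program f
    byWeight : DecTotalOrder _ _ _
    byWeight = On.decTotalOrder ≤-decTotalOrder (∣_∣ {n})
    open Sort byWeight using (sort; sort-↭; sort-↗)
    ys = sort C
    sorted : AllPairs (λ a b → ∣ a ∣ ≤ ∣ b ∣) ys
    sorted = Linked⇒AllPairs ≤-trans (sort-↗ C)
    computes : Computes n (program ys) f
    computes x with covers x
    ... | y , y∈ , near = program-halts ys sorted (∈-resp-↭ (↭-sym (sort-↭ C)) y∈) near
    allowed : All NoAuxOnlyJump2 (program ys)
    allowed = All-concatMap block (λ y → ++⁺ (segment-ok y _ _) (segment-ok y _ _)) ys
    length-block : ∀ y → length (block y) ≤ 8 * n + 6
    length-block y = begin
      length (block y)                              ≡⟨ length-++ (segment y (agrees y) (f y)) ⟩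
      length (segment y (agrees y) (f y)) + length (segment y (λ _ → true) (not (f y)))
                                                    ≤⟨ +-mono-≤ (length-segment y _ _) (length-segment y _ _) ⟩
      ((n + n) * 2 + 3) + ((n + n) * 2 + 3)         ≡⟨ collect n ⟩
      8 * n + 6                                     ∎
      where
      open ≤-Reasoning
      collect : ∀ n → ((n + n) * 2 + 3) + ((n + n) * 2 + 3) ≡ 8 * n + 6
      collect = solve-∀
    short : length (program ys) ≤ 268 * 2 ^ n
    short = begin
      length (program ys)                      ≤⟨ length-concatMap-≤ block length-block ys ⟩
      length ys * (8 * n + 6)                  ≡⟨ cong (_* (8 * n + 6)) (↭-length (sort-↭ C)) ⟩
      length C * (8 * n + 6)                   ≡⟨ expand (length C) n ⟩
      8 * (length C * n) + 6 * length C        ≤⟨ +-mono-≤ (*-monoʳ-≤ 8 dense) (*-monoʳ-≤ 6 small) ⟩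
      8 * (32 * 2 ^ n) + 6 * (2 * 2 ^ n)       ≡⟨ collect (2 ^ n) ⟩
      268 * 2 ^ n                              ∎
      where
      open ≤-Reasoning
      expand : ∀ c n → c * (8 * n + 6) ≡ 8 * (c * n) + 6 * c
      expand = solve-∀
      collect : ∀ p → 8 * (32 * p) + 6 * (2 * p) ≡ 268 * p
      collect = solve-∀
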